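{- Let $i\ge 3$ and $k\ge 3$ be integers. Then: (a) $g_1(F_i,F_{i+2},F_{i+k})=(2F_i-1)F_{i+2}-F_i$ whenever $k\ge i+2$; (b) $g_1(F_i,F_{i+2},F_{2i+1})=(F_{i-2}-1)F_{i+2}+F_{2i+1}-F_i$; (c) $g_1(F_i,F_{i+2},F_{2i})=(F_i-1)F_{i+2}+F_{2i}-F_i$; (d) if $r=\lfloor (F_i-1)/F_k\rfloor\ge 1$ (equivalently $k\le i-1$), then $$g_1(F_i,F_{i+2},F_{i+k})=\begin{cases}(F_i-rF_k-1)F_{i+2}+(r+1)F_{i+k}-F_i & \text{if } (F_i-rF_k)F_{i+2}\ge F_{k-2}F_i,\\ (F_k-1)F_{i+2}+rF_{i+k}-F_i & \text{if } (F_i-rF_k)F_{i+2}< F_{k-2}F_i.\end{cases}$$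
   Context: Fibonacci numbers: $F_0=0$, $F_1=1$, $F_n=F_{n-1}+F_{n-2}$. For positive integers $a_1,\dots,a_l$ with $\gcd(a_1,\dots,a_l)=1$ and an integer $n$, let $d(n;a_1,\dots,a_l)$ be the number of tuples $(x_1,\dots,x_l)$ of nonnegative integers with $a_1x_1+\dots+a_lx_l=n$. For a nonnegative integer $p$, the $p$-Frobenius number $g_p(a_1,\dots,a_l)$ is the largest integer $n$ with $d(n;a_1,\dots,a_l)\le p$. -}

module Defs where

open import Data.Fin.Base using (Fin; zero; suc)
open import Data.Integer.Base as ℤ using (ℤ; +_; -[1+_])
open import Data.Integer.Properties using (+-injective)
open import Data.List.Base
  using (List; []; _∷_; [_]; length; lookup; filter; upTo; cartesianProductWith)
open import Data.List.Membership.Propositional using (_∈_)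
open import Data.List.Membership.Propositional.Properties
  using (∈-lookup; ∈-filter⁺; ∈-filter⁻; ∈-upTo⁺; ∈-cartesianProductWith⁺)
import Data.List.Relation.Unary.All as ListAll
open import Data.List.Relation.Unary.AllPairs using ([]; _∷_)
open import Data.List.Relation.Unary.Any using (here; index)
open import Data.List.Relation.Unary.Any.Properties using (lookup-index)
open import Data.List.Relation.Unary.Unique.Propositional using (Unique)
import Data.List.Relation.Unary.Unique.Propositional.Properties as Uniqueₚ
open import Data.Nat.Base
open import Data.Nat.Properties
open import Data.Product.Base using (Σ-syntax; _×_; _,_; proj₁; proj₂)
open import Data.Vec.Base as Vec using (Vec; []; _∷_)
open import Data.Vec.Properties using (∷-injective)
open import Data.Vec.Relation.Unary.All using (All; []; _∷_)
open import Function.Bundles using (_↔_; mk↔ₛ′)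
open import Relation.Binary.PropositionalEquality using (_≡_; refl; sym; cong)
open import Relation.Nullary.Negation using (contradiction)

F : ℕ → ℕ
F 0             = 0
F 1             = 1
F (suc (suc n)) = F (suc n) + F n

F-nonZero : ∀ n → .{{NonZero n}} → NonZero (F n)
F-nonZero 1             = _
F-nonZero (suc (suc n)) =
  >-nonZero (≤-trans (>-nonZero⁻¹ _ {{F-nonZero (suc n)}}) (m≤m+n _ (F n)))

infix 7 _·_

_·_ : ∀ {l} → Vec ℕ l → Vec ℕ l → ℕ
as · xs = Vec.sum (Vec.zipWith _*_ as xs)

Representation : ∀ {l} → Vec ℕ l → ℤ → Set
Representation {l} as n = Σ[ xs ∈ Vec ℕ l ] + (as · xs) ≡ n

box : ℕ → (l : ℕ) → List (Vec ℕ l)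
box b zero    = [ [] ]
box b (suc l) = cartesianProductWith _∷_ (upTo (suc b)) (box b l)

representations : ∀ {l} → Vec ℕ l → ℕ → List (Vec ℕ l)
representations {l} as n = filter (λ xs → as · xs ≟ n) (box n l)

-- When the aⱼ are positive, every representation of n ≥ 0 has entries at most
-- n, so the search can be confined to a box; see d-counts.
d : ∀ {l} → Vec ℕ l → ℤ → ℕ
d as (+ n)    = length (representations as n)
d as -[1+ n ] = 0

-- The coefficients are meant to be positive.  That they have greatest common
-- divisor 1 is needed only for a Frobenius number to exist.
IsFrobeniusNumber : ∀ {l} → ℕ → Vec ℕ l → ℤ → Set
IsFrobeniusNumber p as g = d as g ≤ p × (∀ n → d as n ≤ p → n ℤ.≤ g)

box-unique : ∀ b l → Unique (box b l)
box-unique b zero    = ListAll.[] ∷ []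
box-unique b (suc l) = Uniqueₚ.cartesianProductWith⁺ _∷_ ∷-injective
  (Uniqueₚ.upTo⁺ (suc b)) (box-unique b l)

∈-box : ∀ {l b} (as xs : Vec ℕ l) → All NonZero as → as · xs ≤ b → xs ∈ box b l
∈-box []       []       []         _  = here refl
∈-box (a ∷ as) (x ∷ xs) (a≢0 ∷ nz) le =
  ∈-cartesianProductWith⁺ _∷_
    (∈-upTo⁺ (s≤s (≤-trans (m≤n*m x a {{a≢0}}) (m+n≤o⇒m≤o (a * x) le))))
    (∈-box as xs nz (m+n≤o⇒n≤o (a * x) le))

lookup-injective : ∀ {A : Set} {xs : List A} → Unique xs →
                   ∀ i j → lookup xs i ≡ lookup xs j → i ≡ j
lookup-injective (_ ∷ _)   zero    zero    _  = refl
lookup-injective (x∉ ∷ _)  zero    (suc j) eq = contradiction eq (ListAll.lookup x∉ (∈-lookup j))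
lookup-injective (x∉ ∷ _)  (suc i) zero    eq = contradiction (sym eq) (ListAll.lookup x∉ (∈-lookup i))
lookup-injective (_ ∷ xs!) (suc i) (suc j) eq = cong suc (lookup-injective xs! i j eq)

d-counts : ∀ {l} (as : Vec ℕ l) → All NonZero as →
           ∀ n → Fin (d as n) ↔ Representation as n
d-counts {l} as nz -[1+ n ] = mk↔ₛ′ (λ ()) (λ { (_ , ()) }) (λ { (_ , ()) }) (λ ())
d-counts {l} as nz (+ n)    = mk↔ₛ′ to from to∘from from∘to
  where
  P? = λ (xs : Vec ℕ l) → as · xs ≟ n

  reps : List (Vec ℕ l)
  reps = representations as n

  complete : (r : Representation as (+ n)) → proj₁ r ∈ reps
  complete (xs , eq) =
    ∈-filter⁺ P? (∈-box as xs nz (≤-reflexive (+-injective eq))) (+-injective eq)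

  to : Fin (length reps) → Representation as (+ n)
  to i = lookup reps i ,
    cong +_ (proj₂ (∈-filter⁻ P? {xs = box n l} (∈-lookup {xs = reps} i)))

  from : Representation as (+ n) → Fin (length reps)
  from r = index (complete r)

  Representation-≡ : {r s : Representation as (+ n)} → proj₁ r ≡ proj₁ s → r ≡ s
  Representation-≡ {_ , refl} {_ , refl} refl = refl

  to∘from : ∀ r → to (from r) ≡ r
  to∘from r = Representation-≡ (sym (lookup-index (complete r)))

  from∘to : ∀ i → from (to i) ≡ i
  from∘to i = lookup-injective (Uniqueₚ.filter⁺ P? (box-unique n l)) _ _
    (sym (lookup-index (complete (to i))))

{-# OPTIONS --safe #-}

-- With a = F i, b = F (i+2), c = F (i+k), q = F k and s = F (k-2) one has
-- c + s a = q b.  Hence b y + c z = b w - s a z for w = y + q z, and the number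
-- of representations of n ≡ b t (mod a) is the number of pairs (y , z) with
-- w ≡ t (mod a) and b y + c z ≤ n.  So g₁ + a is the largest, over t < a, of the
-- second smallest values of b y + c z in the class of t.  If y₀ + q Z = t + a
-- with t, y₀ < q and s (a + y₀) ≤ q b, then below b y₀ + c Z the class of t
-- contains only (t , 0); the candidates for the maximum are obtained from
-- t = a - 1 when a ≤ q, and from t = q - 1 and y₀ = q - 1 when q < a.

module Submission where

open import Defs

-- Congruences modulo `a`, and triples of generators with one linear relation.

module Residues where

  open import Data.Nat.Base
  open import Data.Nat.Properties
  open import Data.Nat.Divisibility
  open import Data.Nat.DivMod
  open import Data.Nat.Coprimality using (Coprime; coprime-Bézout; coprime-divisor)
  open import Data.Nat.GCD using (module Bézout)
  open import Data.Nat.Tactic.RingSolver using (solve-∀; solve)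
  import Data.List.Base as List
  open import Data.Fin.Base using (Fin; zero; suc)
  import Data.Integer as ℤ
  open ℤ using (ℤ; +_)
  import Data.Integer.Properties as ℤ
  open import Algebra.Properties.AbelianGroup ℤ.+-0-abelianGroup using (∙-cancelʳ)
  open import Data.Product.Base using (∃-syntax; ∃₂; _×_; _,_; proj₁; proj₂)
  open import Data.Empty using (⊥)
  open import Data.Sum.Base using (inj₁; inj₂)
  open import Data.Vec.Base using (Vec; []; _∷_)
  open import Data.Vec.Relation.Unary.All using (All; []; _∷_)
  open import Function.Bundles using (_↣_; Injection)
  open import Function.Properties.Inverse using (↔⇒↣; ↔-sym)
  open import Relation.Binary.PropositionalEquality
  open import Relation.Nullary.Negation using (contradiction)

  -- Congruences modulo a are written w + a * m ≡ v + a * n, which avoids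
  -- subtraction.
  ∣-difference : ∀ a {o} m n → o + a * m ≡ a * n → a ∣ o
  ∣-difference a {o} m n eq = ∣m+n∣n⇒∣m (subst (a ∣_) (sym eq) (m∣m*n n)) (m∣m*n m)
    where
    ∣m+n∣n⇒∣m : ∀ {x y} → a ∣ x + y → a ∣ y → a ∣ x
    ∣m+n∣n⇒∣m {x} {y} p = ∣m+n∣m⇒∣n (subst (a ∣_) (+-comm x y) p)

  -- Coprimality cancels `b`, so `a` divides the difference of `w` and `t`. If `w` were smaller,
  -- that difference would be positive and below `a`.
  reduce-residue : ∀ {a b t w} m n → Coprime a b → t < a →
                   b * w + a * m ≡ b * t + a * n → ∃[ j ] w ≡ t + j * a
  reduce-residue {a} {b} {t} {w} m n coprime t<a eq with ≤-total t w
  ... | inj₁ t≤w with m≤n⇒∃[o]m+o≡n t≤w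
  ...   | o , refl with coprime-divisor coprime (∣-difference a m n
                          (+-cancelˡ-≡ (b * t) _ _ (trans (lemma a b t o m) eq)))
    where
    lemma : ∀ a b t o m → b * t + (b * o + a * m) ≡ b * (t + o) + a * m
    lemma = solve-∀
  ...     | divides j refl = j , refl
  reduce-residue {a} {b} {t} {w} m n coprime t<a eq | inj₂ w≤t
    with m≤n⇒∃[o]m+o≡n w≤t
  ...   | zero  , refl = 0 , sym (trans (+-identityʳ (w + 0)) (+-identityʳ w))
  ...   | suc o , refl = contradiction
      (∣⇒≤ (coprime-divisor coprime (∣-difference a n m
        (+-cancelˡ-≡ (b * w) _ _ (trans (lemma a b w (suc o) n) (sym eq))))))
      (<⇒≱ (≤-<-trans (m≤n+m (suc o) w) t<a))
    where
    lemma : ∀ a b w o n → b * w + (b * o + a * n) ≡ b * (w + o) + a * n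
    lemma = solve-∀

  invert : ∀ {a b} .{{_ : NonZero a}} → Coprime a b →
           ∃[ u ] ∃₂ λ m n → b * u + a * m ≡ 1 + a * n
  invert {suc a} {b} coprime with coprime-Bézout coprime
  ... | Bézout.-+ x y eq = y , 0 , x ,
          trans (lemma a b y) (trans (sym eq) (cong suc (*-comm x (suc a))))
    where
    lemma : ∀ a b y → b * y + suc a * 0 ≡ y * b
    lemma = solve-∀
  -- In this case `y` inverts `b` only up to sign. The modulus is `suc a`, so `a` is congruent to -1
  -- and the factor `a` repairs the sign.
  ... | Bézout.+- x y eq = y * a , 1 , x * a ,
          trans (lemma a b y) (trans (cong (λ e → 1 + a * e) eq) (lemma′ a x))
    where
    lemma : ∀ a b y → b * (y * a) + suc a * 1 ≡ 1 + a * (1 + y * b)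
    lemma = solve-∀
    lemma′ : ∀ a x → 1 + a * (x * suc a) ≡ 1 + suc a * (x * a)
    lemma′ = solve-∀

  -- `t` is `m` times the inverse of `b`, reduced modulo `a`. It selects the class in which two
  -- pairs will be looked up.
  divide-residue : ∀ {a b} .{{_ : NonZero a}} → Coprime a b → ∀ m →
                   ∃[ t ] t < a × ∃₂ λ k n → m + a * k ≡ b * t + a * n
  divide-residue {a} {b} coprime m with invert coprime
  ... | u , k , n , eq = mu % a , m%n<n mu a , m * n , b * (mu / a) + m * k , (begin
      m + a * (m * n)                              ≡⟨ lemma₁ a m n ⟩
      m * (1 + a * n)                              ≡⟨ cong (m *_) eq ⟨
      m * (b * u + a * k)                          ≡⟨ lemma₂ a b m u k ⟩
      b * mu + a * (m * k)                         ≡⟨ cong (λ e → b * e + a * (m * k)) (m≡m%n+[m/n]*n mu a) ⟩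
      b * (mu % a + mu / a * a) + a * (m * k)      ≡⟨ lemma₃ a b (mu % a) (mu / a) (m * k) ⟩
      b * (mu % a) + a * (b * (mu / a) + m * k)    ∎)
    where
    open ≡-Reasoning
    mu = m * u
    lemma₁ : ∀ a m n → m + a * (m * n) ≡ m * (1 + a * n)
    lemma₁ = solve-∀
    lemma₂ : ∀ a b m u k → m * (b * u + a * k) ≡ b * (m * u) + a * (m * k)
    lemma₂ = solve-∀
    lemma₃ : ∀ a b v w k → b * (v + w * a) + a * k ≡ b * v + a * (b * w + k)
    lemma₃ = solve-∀

  -- Counts at most one.

  Fin↣subsingleton : ∀ {m} {A : Set} → Fin m ↣ A → (∀ (x y : A) → x ≡ y) → m ≤ 1
  Fin↣subsingleton {zero}        f A-prop = z≤n
  Fin↣subsingleton {suc zero}    f A-prop = ≤-refl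
  Fin↣subsingleton {suc (suc m)} f A-prop
    with () ← Injection.injective f {zero} {suc zero} (A-prop _ _)

  Fin-subsingleton : ∀ {m} → m ≤ 1 → (i j : Fin m) → i ≡ j
  Fin-subsingleton (s≤s z≤n) zero zero = refl

  Representation-≡ : ∀ {l} {as : Vec ℕ l} {n} {r r′ : Representation as n} →
                     proj₁ r ≡ proj₁ r′ → r ≡ r′
  Representation-≡ {r = _ , refl} {_ , refl} refl = refl

  -- Values of pairs (y , z) under the relation c + s a = q b.

  module Triple (a b c q s : ℕ) .{{_ : NonZero a}} .{{_ : NonZero b}} .{{_ : NonZero c}}
                (coprime : Coprime a b) (relation : c + s * a ≡ q * b) where

    as : Vec ℕ 3
    as = a ∷ b ∷ c ∷ []

    as-nonZero : All NonZero as
    as-nonZero = it ∷ it ∷ it ∷ []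
      where
      it : ∀ {n} → .{{NonZero n}} → NonZero n
      it {suc n} = _

    -- The value equals b w - s a z for w = y + q z, written additively. Read modulo `a` it gives
    -- the residue of the value; read as an equation it compares sizes.
    value+ : ∀ y z → b * y + c * z + s * a * z ≡ b * (y + q * z)
    value+ y z = begin
      b * y + c * z + s * a * z  ≡⟨ lemma₁ a b c s y z ⟩
      b * y + (c + s * a) * z    ≡⟨ cong (λ e → b * y + e * z) relation ⟩
      b * y + q * b * z          ≡⟨ lemma₂ b q y z ⟩
      b * (y + q * z)            ∎
      where
      open ≡-Reasoning
      lemma₁ : ∀ a b c s y z → b * y + c * z + s * a * z ≡ b * y + (c + s * a) * z
      lemma₁ = solve-∀
      lemma₂ : ∀ b q y z → b * y + q * b * z ≡ b * (y + q * z)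
      lemma₂ = solve-∀

    -- Uniqueness below the second smallest value of a class.

    module _ {t y₀ Z : ℕ} (t<a : t < a) (t<q : t < q) (y₀<q : y₀ < q)
             (bound : s * (a + y₀) ≤ q * b) (top : y₀ + q * Z ≡ t + a) where

      private instance
        q≢0 : NonZero q
        q≢0 = >-nonZero (≤-<-trans z≤n t<q)

      -- The coefficient is `suc x` because a representation of `g` is turned into one of `g + a`,
      -- the value of (y₀ , Z). This also makes the value of (y , z) strictly smaller than that of
      -- (y₀ , Z).
      residue : ∀ {x y z} → a * suc x + (b * y + c * z) ≡ b * y₀ + c * Z →
                ∃[ j ] y + q * z ≡ t + j * a
      residue {x} {y} {z} eq = reduce-residue (suc x + s * Z) (b + s * z) coprime t<a (begin
        b * (y + q * z) + a * (suc x + s * Z)                          ≡⟨ cong (_+ a * (suc x + s * Z)) (value+ y z) ⟨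
        b * y + c * z + s * a * z + a * (suc x + s * Z)                ≡⟨ lemma₁ a s (suc x) Z (b * y + c * z) z ⟩
        a * suc x + (b * y + c * z) + s * a * Z + s * a * z            ≡⟨ cong (λ e → e + s * a * Z + s * a * z) eq ⟩
        b * y₀ + c * Z + s * a * Z + s * a * z                         ≡⟨ cong (_+ s * a * z) (value+ y₀ Z) ⟩
        b * (y₀ + q * Z) + s * a * z                                   ≡⟨ cong (λ e → b * e + s * a * z) top ⟩
        b * (t + a) + s * a * z                                        ≡⟨ lemma₂ a b s t z ⟩
        b * t + a * (b + s * z)                                        ∎)
        where
        open ≡-Reasoning
        lemma₁ : ∀ a s x Z v z → v + s * a * z + a * (x + s * Z) ≡ a * x + v + s * a * Z + s * a * z
        lemma₁ = solve-∀
        lemma₂ : ∀ a b s t z → b * (t + a) + s * a * z ≡ b * t + a * (b + s * z)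
        lemma₂ = solve-∀

      -- Values are b w - s a z. For z ≤ Z, `w` is at least t + a and no more is subtracted than for
      -- (y₀ , Z). For z = Z + u, the additional deduction s a u has to be covered by the additional
      -- b j a, which amounts to s u ≤ b j.
      value-bound : ∀ {y z j} → y + q * z ≡ t + suc j * a → b * y₀ + c * Z ≤ b * y + c * z
      value-bound {y} {z} {j} eq with ≤-total z Z
      ... | inj₁ z≤Z = +-cancelʳ-≤ (s * a * z) _ _ (begin
          b * y₀ + c * Z + s * a * z  ≤⟨ +-monoʳ-≤ (b * y₀ + c * Z) (*-monoʳ-≤ (s * a) z≤Z) ⟩
          b * y₀ + c * Z + s * a * Z  ≡⟨ value+ y₀ Z ⟩
          b * (y₀ + q * Z)            ≡⟨ cong (b *_) top ⟩
          b * (t + a)                 ≤⟨ *-monoʳ-≤ b (+-monoʳ-≤ t (m≤m+n a (j * a))) ⟩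
          b * (t + suc j * a)         ≡⟨ cong (b *_) eq ⟨
          b * (y + q * z)             ≡⟨ value+ y z ⟨
          b * y + c * z + s * a * z   ∎)
        where open ≤-Reasoning
      ... | inj₂ Z≤z with m≤n⇒∃[o]m+o≡n Z≤z
      ...   | u , refl = begin
          b * y₀ + c * Z          ≤⟨ +-monoˡ-≤ (c * Z) (+-cancelʳ-≤ (s * a * u) _ _ shifted) ⟩
          b * y + c * u + c * Z   ≡⟨ lemma b c y u Z ⟩
          b * y + c * (Z + u)     ∎
        where
        open ≤-Reasoning
        lemma : ∀ b c y u Z → b * y + c * u + c * Z ≡ b * y + c * (Z + u)
        lemma = solve-∀

        excess : y + q * u ≡ y₀ + j * a
        excess = +-cancelʳ-≡ (q * Z) _ _ (≡.begin
          y + q * u + q * Z    ≡.≡⟨ solve (y List.∷ q List.∷ u List.∷ Z List.∷ List.[]) ⟩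
          y + q * (Z + u)      ≡.≡⟨ eq ⟩
          t + suc j * a        ≡.≡⟨ solve (t List.∷ j List.∷ a List.∷ List.[]) ⟩
          t + a + j * a        ≡.≡⟨ cong (_+ j * a) top ⟨
          y₀ + q * Z + j * a   ≡.≡⟨ solve (y₀ List.∷ q List.∷ Z List.∷ j List.∷ a List.∷ List.[]) ⟩
          y₀ + j * a + q * Z   ≡.∎)
          where module ≡ = ≡-Reasoning

        -- For j = 0, y₀ < q leaves no room for a positive multiple of `q`, so u = 0. For j ≥ 1,
        -- multiply by `q` and use q u ≤ y₀ + j a ≤ j (y₀ + a), so that `bound` applies `j` times.
        s*u≤b*j : ∀ j u → y + q * u ≡ y₀ + j * a → s * u ≤ b * j
        s*u≤b*j zero    zero    _  = ≤-reflexive (trans (*-zeroʳ s) (sym (*-zeroʳ b)))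
        s*u≤b*j zero    (suc u) eq = contradiction y₀<q (≤⇒≯ (begin
          q                ≤⟨ m≤m*n q (suc u) ⟩
          q * suc u        ≤⟨ m≤n+m (q * suc u) y ⟩
          y + q * suc u    ≡⟨ eq ⟩
          y₀ + 0           ≡⟨ +-identityʳ y₀ ⟩
          y₀               ∎))
        s*u≤b*j j@(suc _) u     eq = *-cancelˡ-≤ q (begin
          q * (s * u)             ≡⟨ solve (q List.∷ s List.∷ u List.∷ List.[]) ⟩
          s * (q * u)             ≤⟨ *-monoʳ-≤ s (m≤n+m (q * u) y) ⟩
          s * (y + q * u)         ≡⟨ cong (s *_) eq ⟩
          s * (y₀ + j * a)        ≤⟨ *-monoʳ-≤ s (+-monoˡ-≤ (j * a) (m≤n*m y₀ j)) ⟩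
          s * (j * y₀ + j * a)    ≡⟨ lemma₁ s j y₀ a ⟩
          j * (s * (a + y₀))      ≤⟨ *-monoʳ-≤ j bound ⟩
          j * (q * b)             ≡⟨ lemma₂ j q b ⟩
          q * (b * j)             ∎)
          where
          lemma₁ : ∀ s j y a → s * (j * y + j * a) ≡ j * (s * (a + y))
          lemma₁ = solve-∀
          lemma₂ : ∀ j q b → j * (q * b) ≡ q * (b * j)
          lemma₂ = solve-∀

        shifted : b * y₀ + s * a * u ≤ b * y + c * u + s * a * u
        shifted = begin
          b * y₀ + s * a * u          ≡⟨ solve (b List.∷ y₀ List.∷ s List.∷ a List.∷ u List.∷ List.[]) ⟩
          b * y₀ + a * (s * u)        ≤⟨ +-monoʳ-≤ (b * y₀) (*-monoʳ-≤ a (s*u≤b*j j u excess)) ⟩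
          b * y₀ + a * (b * j)        ≡⟨ solve (b List.∷ y₀ List.∷ a List.∷ j List.∷ List.[]) ⟩
          b * (y₀ + j * a)            ≡⟨ cong (b *_) excess ⟨
          b * (y + q * u)             ≡⟨ value+ y u ⟨
          b * y + c * u + s * a * u   ∎

      -- A value strictly below that of (y₀ , Z) rules out w ≥ t + a by `value-bound`, and w = t < q
      -- forces z = 0.
      unique-below : ∀ {x y z} → a * suc x + (b * y + c * z) ≡ b * y₀ + c * Z →
                     y ≡ t × z ≡ 0
      unique-below {x} {y} {z} eq with residue {x} {y} {z} eq
      ... | suc j , eq′ = contradiction (value-bound {j = j} eq′) (<⇒≱ (begin-strict
          b * y + c * z                  <⟨ m<n+m (b * y + c * z) {a * suc x} (>-nonZero⁻¹ (a * suc x) {{m*n≢0 a (suc x)}}) ⟩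
          a * suc x + (b * y + c * z)    ≡⟨ eq ⟩
          b * y₀ + c * Z                 ∎))
        where open ≤-Reasoning
      unique-below {x} {y} {zero} eq | zero , eq′ =
        trans (sym (trans (cong (λ e → y + e) (*-zeroʳ q)) (+-identityʳ y))) (trans eq′ (+-identityʳ t)) , refl
      unique-below {x} {y} {suc z} eq | zero , eq′ = contradiction t<q (≤⇒≯ (begin
          q                ≤⟨ m≤m*n q (suc z) ⟩
          q * suc z        ≤⟨ m≤n+m (q * suc z) y ⟩
          y + q * suc z    ≡⟨ eq′ ⟩
          t + 0            ≡⟨ +-identityʳ t ⟩
          t                ∎))
        where open ≤-Reasoning

    -- A criterion for the 1-Frobenius number.

    -- A pair (y , z) stands for the value b y + c z, which is ≡ b (y + q z) mod a.
    Reaches : ℕ → ℕ → ℕ × ℕ → Set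
    Reaches G t (y , z) = (∃[ j ] y + q * z ≡ t + j * a) × b * y + c * z ≤ G

    -- Since `b` is invertible modulo `a`, letting `t` run over all residues covers every class. Two
    -- pairs in each class yield two representations of every integer above G - a.
    TwicePerResidue : ℕ → Set
    TwicePerResidue G = ∀ t → t < a →
      ∃₂ λ p p′ → p ≢ p′ × Reaches G t p × Reaches G t p′

    -- `m` is congruent to the value of the pair and strictly larger, so the difference is a
    -- positive multiple of `a`. The multiplier `suc x` leaves a nonnegative `x` when `m` is n + a
    -- and one `a` is removed.
    represent : ∀ {G t m k n y z} → G < m → m + a * k ≡ b * t + a * n →
                Reaches G t (y , z) → ∃[ x ] m ≡ a * suc x + (b * y + c * z)
    represent {m = m} {k} {n} {y} {z} G<m eq ((j , eq′) , v≤G)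
      with m≤n⇒∃[o]m+o≡n (<⇒≤ (≤-<-trans v≤G G<m))
    ... | zero , refl = contradiction (≤-<-trans v≤G G<m) (v≮v+0 (b * y + c * z))
      where
      v≮v+0 : ∀ v → v ≮ v + 0
      v≮v+0 v = ≤⇒≯ (≤-reflexive (+-identityʳ v))
    ... | o@(suc _) , refl with ∣-difference a (b * j + k) (s * z + n) divisible
      where
      open ≡-Reasoning
      v = b * y + c * z
      lemma₁ : ∀ a b j k o v → v + (o + a * (b * j + k)) ≡ v + o + a * k + a * (b * j)
      lemma₁ = solve-∀
      lemma₂ : ∀ a b t n j → b * t + a * n + a * (b * j) ≡ b * (t + j * a) + a * n
      lemma₂ = solve-∀
      lemma₃ : ∀ a s z n v → v + s * a * z + a * n ≡ v + a * (s * z + n)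
      lemma₃ = solve-∀
      divisible : o + a * (b * j + k) ≡ a * (s * z + n)
      divisible = +-cancelˡ-≡ v _ _ (begin
        v + (o + a * (b * j + k))      ≡⟨ lemma₁ a b j k o v ⟩
        v + o + a * k + a * (b * j)    ≡⟨ cong (_+ a * (b * j)) eq ⟩
        b * _ + a * n + a * (b * j)    ≡⟨ lemma₂ a b _ n j ⟩
        b * (_ + j * a) + a * n        ≡⟨ cong (λ e → b * e + a * n) eq′ ⟨
        b * (y + q * z) + a * n        ≡⟨ cong (_+ a * n) (value+ y z) ⟨
        v + s * a * z + a * n          ≡⟨ lemma₃ a s z n v ⟩
        v + a * (s * z + n)            ∎)
    ...   | divides (suc x) o≡ = x ,
              trans (cong (λ e → b * y + c * z + e) (trans o≡ (*-comm (suc x) a)))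
                    (+-comm (b * y + c * z) (a * suc x))

    -- The conditions on `t`, `y₀` and `Z` leave `g` at most one representation, and
    -- `TwicePerResidue` gives two to every larger integer. Prescribing `g + a` rather than `g`
    -- keeps the comparison inside the natural numbers.
    frobenius₁ : ∀ {t y₀ Z g} → t < a → t < q → y₀ < q → s * (a + y₀) ≤ q * b →
                 y₀ + q * Z ≡ t + a → g ℤ.+ + a ≡ + (b * y₀ + c * Z) →
                 TwicePerResidue (b * y₀ + c * Z) → IsFrobeniusNumber 1 as g
    frobenius₁ {t} {y₀} {Z} {g} t<a t<q y₀<q bound top g+a≡G twice = d[g]≤1 , maximal
      where
      G = b * y₀ + c * Z

      as· : ∀ x y z → a * suc x + (b * y + c * z) ≡ as · (x ∷ y ∷ z ∷ []) + a
      as· x y z = trans (lemma a x (b * y + c * z))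
                        (cong (λ e → a * x + (b * y + e) + a) (sym (+-identityʳ (c * z))))
        where
        lemma : ∀ a x v → a * suc x + v ≡ a * x + v + a
        lemma = solve-∀

      entries : (r : Representation as g) →
                ∃[ x ] proj₁ r ≡ x ∷ t ∷ 0 ∷ [] × a * suc x + (b * t + c * 0) ≡ G
      entries (x ∷ y ∷ z ∷ [] , eq)
        with eq′ ← ℤ.+-injective (trans (cong +_ (as· x y z)) (trans (cong (ℤ._+ + a) eq) g+a≡G))
        with refl , refl ← unique-below t<a t<q y₀<q bound top {x} {y} {z} eq′
        = x , refl , eq′

      d[g]≤1 : d as g ≤ 1
      d[g]≤1 = Fin↣subsingleton (↔⇒↣ (d-counts as as-nonZero g)) λ r r′ → Representation-≡ {as = as} (agree r r′)
        where
        agree : ∀ r r′ → proj₁ r ≡ proj₁ r′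
        agree r r′ with entries r | entries r′
        ... | x , r≡ , eq | x′ , r′≡ , eq′ = trans r≡ (trans (cong (_∷ t ∷ 0 ∷ [])
          (suc-injective (*-cancelˡ-≡ (suc x) (suc x′) a
            (+-cancelʳ-≡ (b * t + c * 0) _ _ (trans eq (sym eq′)))))) (sym r′≡))

      maximal : ∀ n → d as n ≤ 1 → n ℤ.≤ g
      maximal n d≤1 = ℤ.≮⇒≥ contradict
        where
        contradict : g ℤ.< n → ⊥
        contradict g<n
          -- The sum `n + a` exceeds a natural number, hence is some `+ m`, whatever the sign of
          -- `n`.
          with n ℤ.+ + a in n+a≡m | subst (ℤ._< n ℤ.+ + a) g+a≡G (ℤ.+-monoˡ-< (+ a) g<n)
        ... | + m | ℤ.+<+ G<m
          with t , t<a , k , k′ , eq ← divide-residue {b = b} coprime m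
          with (y , z) , (y′ , z′) , p≢p′ , below , below′ ← twice t t<a
          with x , eq₁ ← represent {m = m} {k} {k′} {y} {z} G<m eq below
          with x′ , eq₂ ← represent {m = m} {k} {k′} {y′} {z′} G<m eq below′
          = p≢p′ (cong (λ r → yz (proj₁ r)) (Injection.injective (↔⇒↣ (↔-sym (d-counts as as-nonZero n)))
              {x ∷ y ∷ z ∷ [] , rep x y z eq₁} {x′ ∷ y′ ∷ z′ ∷ [] , rep x′ y′ z′ eq₂}
              (Fin-subsingleton d≤1 _ _)))
          where
          rep : ∀ x y z → m ≡ a * suc x + (b * y + c * z) → + (as · (x ∷ y ∷ z ∷ [])) ≡ n
          rep x y z eq = ∙-cancelʳ (+ a) _ _ (trans (cong +_ (trans (sym (as· x y z)) (sym eq))) (sym n+a≡m))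
          yz : Vec ℕ 3 → ℕ × ℕ
          yz (_ ∷ y ∷ z ∷ []) = y , z

    -- Large and medium `q`: the ranges 2 a ≤ q and a ≤ q < 2 a.

    module _ (2a≤b : 2 * a ≤ b) (2s≤q : 2 * s ≤ q) where

      open ≤-Reasoning

      private
        a≤b : a ≤ b
        a≤b = ≤-trans (m≤n*m a 2) 2a≤b

        s*a≤c : s * a ≤ c
        s*a≤c = +-cancelʳ-≤ (s * a) _ _ (begin
          s * a + s * a  ≡⟨ double s a ⟩
          2 * s * a      ≤⟨ *-mono-≤ 2s≤q a≤b ⟩
          q * b          ≡⟨ relation ⟨
          c + s * a      ∎)
          where
          double : ∀ s a → s * a + s * a ≡ 2 * s * a
          double = solve-∀

        t≢t+a : ∀ t → (t , 0) ≢ (t + a , 0)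
        t≢t+a t eq = m≢1+m+n t (trans (cong proj₁ eq) (trans (cong (λ a → t + a) (sym (suc-pred a))) (+-suc t (pred a))))

        one-step : ∀ t → t + a + q * 0 ≡ t + 1 * a
        one-step t = lemma q t a
          where
          lemma : ∀ q t a → t + a + q * 0 ≡ t + 1 * a
          lemma = solve-∀

        bound : ∀ {y₀} → y₀ ≤ a → s * (a + y₀) ≤ q * b
        bound {y₀} y₀≤a = begin
          s * (a + y₀)  ≤⟨ *-monoʳ-≤ s (+-monoʳ-≤ a y₀≤a) ⟩
          s * (a + a)   ≡⟨ double s a ⟩
          2 * s * a     ≤⟨ *-mono-≤ 2s≤q a≤b ⟩
          q * b         ∎
          where
          double : ∀ s a → s * (a + a) ≡ 2 * s * a
          double = solve-∀

      on-axis : ∀ {G t} → b * t ≤ G → Reaches G t (t , 0)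
      on-axis {G} {t} bt≤G = (0 , cong (λ e → t + e) (*-zeroʳ q)) , (begin
        b * t + c * 0  ≡⟨ cong (λ e → b * t + e) (*-zeroʳ c) ⟩
        b * t + 0      ≡⟨ +-identityʳ (b * t) ⟩
        b * t          ≤⟨ bt≤G ⟩
        G              ∎)

      -- Here t + a < 2 a ≤ q, so w = t + a is attained only with z = 0. The second pair of the
      -- class is (t + a , 0), and its value is largest for t = a - 1.
      frobenius-large-q : ∀ {y₀ g} → 2 * a ≤ q → suc y₀ ≡ 2 * a →
                          g ℤ.+ + a ≡ + (b * y₀ + c * 0) → IsFrobeniusNumber 1 as g
      frobenius-large-q {y₀} 2a≤q y₀≡ g≡ =
        frobenius₁ {t = pred a} {y₀} {0} (≤-reflexive (suc-pred a)) pred[a]<q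
          (subst (_≤ q) (sym y₀≡) 2a≤q) y₀-bound top g≡ twice
        where
        pred[a]<q : pred a < q
        pred[a]<q = subst (_≤ q) (sym (suc-pred a)) (≤-trans (m≤n*m a 2) 2a≤q)

        -- `y₀` = 2 a - 1 may exceed `a`, so `bound` does not apply; instead 2 a ≤ b makes both
        -- summands at most `b`.
        y₀-bound : s * (a + y₀) ≤ q * b
        y₀-bound = begin
          s * (a + y₀)   ≤⟨ *-monoʳ-≤ s (+-mono-≤ a≤b (≤-trans (n≤1+n y₀) (≤-trans (≤-reflexive y₀≡) 2a≤b))) ⟩
          s * (b + b)    ≡⟨ double s b ⟩
          2 * s * b      ≤⟨ *-monoˡ-≤ b 2s≤q ⟩
          q * b          ∎
          where
          double : ∀ s b → s * (b + b) ≡ 2 * s * b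
          double = solve-∀

        top : y₀ + q * 0 ≡ pred a + a
        top = suc-injective (begin-equality
          suc y₀ + q * 0      ≡⟨ cong (λ e → suc y₀ + e) (*-zeroʳ q) ⟩
          suc y₀ + 0          ≡⟨ +-identityʳ (suc y₀) ⟩
          suc y₀              ≡⟨ y₀≡ ⟩
          2 * a               ≡⟨ cong (λ e → a + e) (+-identityʳ a) ⟩
          a + a               ≡⟨ cong (_+ a) (suc-pred a) ⟨
          suc (pred a) + a    ∎)

        twice : TwicePerResidue (b * y₀ + c * 0)
        twice t t<a = (t , 0) , (t + a , 0) , t≢t+a t ,
          on-axis (≤-trans (*-monoʳ-≤ b (≤-trans (m≤m+n t a) t+a≤y₀)) (m≤m+n _ _)) ,
          (1 , one-step t) , +-monoˡ-≤ (c * 0) (*-monoʳ-≤ b t+a≤y₀)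
          where
          t+a≤y₀ : t + a ≤ y₀
          t+a≤y₀ = s≤s⁻¹ (begin
            suc t + a    ≤⟨ +-mono-≤ t<a (m≤m+n a 0) ⟩
            2 * a        ≡⟨ y₀≡ ⟨
            suc y₀       ∎)

      -- The second pair is (t + a , 0) while t + a < q, and (t + a - q , 1) afterwards; the latter
      -- is most expensive at t = a - 1, where it is (y₀ , 1). With 2 a ≤ b, the hypothesis on `s`
      -- gives s a ≤ b (y₀ + 1), which keeps all axis values b y with y < q below it.
      frobenius-medium-q : ∀ {y₀ g} → a ≤ q → q + suc y₀ ≡ 2 * a → s ≤ 2 * suc y₀ →
                           g ℤ.+ + a ≡ + (b * y₀ + c * 1) → IsFrobeniusNumber 1 as g
      frobenius-medium-q {y₀} a≤q y₀≡ s≤ g≡ =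
        frobenius₁ {t = pred a} {y₀} {1} (≤-reflexive (suc-pred a))
          (subst (_≤ q) (sym (suc-pred a)) a≤q)
          (≤-trans y₀<a a≤q) (bound (<⇒≤ y₀<a)) top g≡ twice
        where
        y₀<a : y₀ < a
        y₀<a = +-cancelˡ-≤ a _ _ (begin
          a + suc y₀   ≤⟨ +-monoˡ-≤ (suc y₀) a≤q ⟩
          q + suc y₀   ≡⟨ y₀≡ ⟩
          2 * a        ≡⟨ cong (λ e → a + e) (+-identityʳ a) ⟩
          a + a        ∎)

        top : y₀ + q * 1 ≡ pred a + a
        top = suc-injective (begin-equality
          suc y₀ + q * 1      ≡⟨ cong (λ e → suc y₀ + e) (*-identityʳ q) ⟩
          suc y₀ + q          ≡⟨ +-comm (suc y₀) q ⟩
          q + suc y₀          ≡⟨ y₀≡ ⟩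
          2 * a               ≡⟨ cong (λ e → a + e) (+-identityʳ a) ⟩
          a + a               ≡⟨ cong (_+ a) (suc-pred a) ⟨
          suc (pred a) + a    ∎)

        b*q≤ : b * q ≤ b * suc y₀ + c * 1
        b*q≤ = begin
          b * q                   ≡⟨ *-comm b q ⟩
          q * b                   ≡⟨ relation ⟨
          c + s * a               ≤⟨ +-monoʳ-≤ c (*-monoˡ-≤ a s≤) ⟩
          c + 2 * suc y₀ * a      ≡⟨ lemma a c (suc y₀) ⟩
          2 * a * suc y₀ + c * 1  ≤⟨ +-monoˡ-≤ (c * 1) (*-monoˡ-≤ (suc y₀) 2a≤b) ⟩
          b * suc y₀ + c * 1      ∎
          where
          lemma : ∀ a c y → c + 2 * y * a ≡ 2 * a * y + c * 1
          lemma = solve-∀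

        small : ∀ {y} → y < q → b * y ≤ b * y₀ + c * 1
        small {y} y<q = +-cancelˡ-≤ b _ _ (begin
          b + b * y                ≡⟨ *-suc b y ⟨
          b * suc y                ≤⟨ *-monoʳ-≤ b y<q ⟩
          b * q                    ≤⟨ b*q≤ ⟩
          b * suc y₀ + c * 1       ≡⟨ cong (_+ c * 1) (*-suc b y₀) ⟩
          b + b * y₀ + c * 1       ≡⟨ +-assoc b (b * y₀) (c * 1) ⟩
          b + (b * y₀ + c * 1)     ∎)

        twice : TwicePerResidue (b * y₀ + c * 1)
        twice t t<a with <-≤-connex (t + a) q
        ... | inj₁ t+a<q = (t , 0) , (t + a , 0) , t≢t+a t ,
            on-axis (small (≤-trans t<a a≤q)) , (1 , one-step t) , (begin
              b * (t + a) + c * 0  ≡⟨ cong (λ e → b * (t + a) + e) (*-zeroʳ c) ⟩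
              b * (t + a) + 0      ≡⟨ +-identityʳ _ ⟩
              b * (t + a)          ≤⟨ small t+a<q ⟩
              b * y₀ + c * 1       ∎)
        ... | inj₂ q≤t+a with m≤n⇒∃[o]m+o≡n q≤t+a
        ...   | o , q+o≡t+a = (t , 0) , (o , 1) , (λ ()) ,
            on-axis (small (≤-trans t<a a≤q)) ,
            (1 , trans (shift q o) (trans q+o≡t+a (cong (λ e → t + e) (sym (+-identityʳ a))))) ,
            +-monoˡ-≤ (c * 1) (*-monoʳ-≤ b (s≤s⁻¹ (+-cancelˡ-< q _ _ (begin-strict
              q + o        ≡⟨ q+o≡t+a ⟩
              t + a        <⟨ +-monoˡ-< a t<a ⟩
              a + a        ≡⟨ cong (λ e → a + e) (+-identityʳ a) ⟨
              2 * a        ≡⟨ y₀≡ ⟨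
              q + suc y₀   ∎))))
          where
          shift : ∀ q o → o + q * 1 ≡ q + o
          shift = solve-∀

      -- Small `q`: the range q < a, where a - 1 has quotient `suc r` and remainder `e` modulo `q`.

      module _ {e p r : ℕ} (a≡ : a ≡ suc e + suc r * q) (q≡ : q ≡ suc p) (e<q : e < q) where

        private
          q≤a : q ≤ a
          q≤a = begin
            q                    ≤⟨ m≤n*m q (suc r) ⟩
            suc r * q            ≤⟨ m≤n+m (suc r * q) (suc e) ⟩
            suc e + suc r * q    ≡⟨ a≡ ⟨
            a                    ∎

          instance
            q≢0 : NonZero q
            q≢0 = >-nonZero (≤-<-trans z≤n e<q)

          -- This amounts to q b ≤ 2 c, which follows from the relation and `s*a≤c`. It lets a pair
          -- with many steps of `b` be measured against the corners two layers higher.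
          lower-layer : ∀ y z → b * (y + q) + c * z ≤ b * y + c * (2 + z)
          lower-layer y z = begin
            b * (y + q) + c * z             ≡⟨ lemma₁ b c q y z ⟩
            b * y + q * b + c * z           ≡⟨ cong (λ e → b * y + e + c * z) relation ⟨
            b * y + (c + s * a) + c * z     ≤⟨ +-monoˡ-≤ (c * z) (+-monoʳ-≤ (b * y) (+-monoʳ-≤ c s*a≤c)) ⟩
            b * y + (c + c) + c * z         ≡⟨ lemma₂ b c y z ⟩
            b * y + c * (2 + z)             ∎
            where
            lemma₁ : ∀ b c q y z → b * (y + q) + c * z ≡ b * y + q * b + c * z
            lemma₁ = solve-∀
            lemma₂ : ∀ b c y z → b * y + (c + c) + c * z ≡ b * y + c * (2 + z)
            lemma₂ = solve-∀

          ≤p : ∀ {y} → y < q → y ≤ p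
          ≤p y<q = s≤s⁻¹ (subst (_ <_) q≡ y<q)

        -- Lowering z by one while keeping the residue is cheap as b q ≤ 2 c,
        -- so t = y + q z with z > 0 is served by w = t alone; a class t < q has
        -- to use w = t + a.
        twice-per-residue : ∀ {G} → b * e + c * (2 + r) ≤ G → b * p + c * suc r ≤ G →
                            TwicePerResidue G
        twice-per-residue {G} corner₁ corner₂ t t<a
          with t % q | t / q | m%n<n t q | m≡m%n+[m/n]*n t q
        ... | y | zero | y<q | t≡ with <-≤-connex (t + suc e) q
        -- Now t + a = (t + e + 1) + (r + 1) q. Without a carry past `q` the pair lies under the
        -- corner (p , r + 1); with a carry it lies under (e , r + 2).
        ...   | inj₁ t+1+e<q = (t , 0) , (t + suc e , suc r) , (λ ()) ,
                on-axis (≤-trans (*-monoʳ-≤ b t≤p) (≤-trans (m≤m+n (b * p) (c * suc r)) corner₂)) ,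
                (1 , trans (shift q t (suc e) r) (cong (λ a → t + 1 * a) (sym a≡))) ,
                ≤-trans (+-monoˡ-≤ (c * suc r) (*-monoʳ-≤ b (≤p t+1+e<q))) corner₂
          where
          t≤p : t ≤ p
          t≤p = ≤p (subst (_< q) (sym (trans t≡ (+-identityʳ y))) y<q)
          shift : ∀ q t e r → t + e + q * suc r ≡ t + 1 * (e + suc r * q)
          shift = solve-∀
        ...   | inj₂ q≤t+1+e with m≤n⇒∃[o]m+o≡n q≤t+1+e
        ...     | o , q+o≡ = (t , 0) , (o , 2 + r) , (λ ()) ,
                on-axis (≤-trans (*-monoʳ-≤ b (≤p t<q)) (≤-trans (m≤m+n (b * p) (c * suc r)) corner₂)) ,
                (1 , (begin-equality
                  o + q * (2 + r)              ≡⟨ shift₁ q o r ⟩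
                  q + o + suc r * q            ≡⟨ cong (_+ suc r * q) q+o≡ ⟩
                  t + suc e + suc r * q        ≡⟨ shift₂ t (suc e) (suc r * q) ⟩
                  t + 1 * (suc e + suc r * q)  ≡⟨ cong (λ a → t + 1 * a) a≡ ⟨
                  t + 1 * a                    ∎)) ,
                ≤-trans (+-monoˡ-≤ (c * (2 + r)) (*-monoʳ-≤ b o≤e)) corner₁
          where
          t<q : t < q
          t<q = subst (_< q) (sym (trans t≡ (+-identityʳ y))) y<q
          o≤e : o ≤ e
          o≤e = s≤s⁻¹ (+-cancelˡ-< q _ _ (≤-<-trans (≤-reflexive q+o≡) (+-monoˡ-< (suc e) t<q)))
          shift₁ : ∀ q o r → o + q * (2 + r) ≡ q + o + suc r * q
          shift₁ = solve-∀
          shift₂ : ∀ t e v → t + e + v ≡ t + 1 * (e + v)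
          shift₂ = solve-∀
        twice-per-residue {G} corner₁ corner₂ t t<a | y | suc z | y<q | t≡ =
          (y , suc z) , (y + q , z) , (λ eq → m≢1+m (sym (cong proj₂ eq))) ,
          ((0 , trans (shift₁ q y z) (trans (sym t≡) (sym (+-identityʳ t)))) , ≤-trans upper lower) ,
          ((0 , trans (shift₂ q y z) (trans (sym t≡) (sym (+-identityʳ t)))) , lower)
          where
          m≢1+m : ∀ {m} → m ≢ suc m
          m≢1+m ()
          shift₁ : ∀ q y z → y + q * suc z ≡ y + suc z * q
          shift₁ = solve-∀
          shift₂ : ∀ q y z → y + q + q * z ≡ y + suc z * q
          shift₂ = solve-∀

          c≤b*q : c ≤ b * q
          c≤b*q = begin
            c            ≤⟨ m≤m+n c (s * a) ⟩
            c + s * a    ≡⟨ relation ⟩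
            q * b        ≡⟨ *-comm q b ⟩
            b * q        ∎

          upper : b * y + c * suc z ≤ b * (y + q) + c * z
          upper = begin
            b * y + c * suc z            ≡⟨ lemma₁ b c y z ⟩
            b * y + c + c * z            ≤⟨ +-monoˡ-≤ (c * z) (+-monoʳ-≤ (b * y) c≤b*q) ⟩
            b * y + b * q + c * z        ≡⟨ cong (_+ c * z) (*-distribˡ-+ b y q) ⟨
            b * (y + q) + c * z          ∎
            where
            lemma₁ : ∀ b c y z → b * y + c * suc z ≡ b * y + c + c * z
            lemma₁ = solve-∀

          t< : y + suc z * q < suc e + suc r * q
          t< = subst₂ _<_ t≡ a≡ t<a

          z≤r : z ≤ r
          z≤r = s≤s⁻¹ (s≤s⁻¹ (*-cancelʳ-< q (suc z) (2 + r) (begin-strict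
            suc z * q            ≤⟨ m≤n+m (suc z * q) y ⟩
            y + suc z * q        <⟨ t< ⟩
            suc e + suc r * q    ≤⟨ +-monoˡ-≤ (suc r * q) e<q ⟩
            (2 + r) * q          ∎)))

          lower : b * (y + q) + c * z ≤ G
          -- Two layers up, z < r stays within layer r + 1 and under the corner (p , r + 1). For z =
          -- r, the bound t < a forces y ≤ e, so the corner (e , r + 2) suffices.
          lower with m≤n⇒m<n∨m≡n z≤r
          ... | inj₁ z<r = begin
            b * (y + q) + c * z    ≤⟨ lower-layer y z ⟩
            b * y + c * (2 + z)    ≤⟨ +-mono-≤ (*-monoʳ-≤ b (≤p y<q)) (*-monoʳ-≤ c (s≤s z<r)) ⟩
            b * p + c * suc r      ≤⟨ corner₂ ⟩
            G                      ∎
          ... | inj₂ z≡r = begin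
            b * (y + q) + c * z    ≤⟨ lower-layer y z ⟩
            b * y + c * (2 + z)    ≤⟨ +-mono-≤ (*-monoʳ-≤ b y≤e) (*-monoʳ-≤ c (s≤s (s≤s z≤r))) ⟩
            b * e + c * (2 + r)    ≤⟨ corner₁ ⟩
            G                      ∎
            where
            y≤e : y ≤ e
            y≤e = s≤s⁻¹ (+-cancelʳ-< (suc r * q) _ _ (subst (λ z → y + suc z * q < suc e + suc r * q) z≡r t<))

        -- By b q = c + s a the two corner values differ by b (e + 1) - s a, so (e , r + 2) is the
        -- larger one here. It has w = t + a for t = q - 1.
        frobenius-small-q-≥ : ∀ {g} → s * a ≤ b * suc e →
                              g ℤ.+ + a ≡ + (b * e + c * (2 + r)) → IsFrobeniusNumber 1 as g
        frobenius-small-q-≥ sa≤ g≡ =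
          frobenius₁ {t = p} {e} {2 + r} (≤-trans p<q q≤a) p<q e<q (bound (≤-trans (<⇒≤ e<q) q≤a))
            top g≡ (twice-per-residue ≤-refl corner)
          where
          p<q : p < q
          p<q = ≤-reflexive (sym q≡)
          top : e + q * (2 + r) ≡ p + a
          top = suc-injective (begin-equality
            suc e + q * (2 + r)            ≡⟨ lemma (suc e) q (suc r) ⟩
            q + (suc e + suc r * q)        ≡⟨ cong₂ _+_ q≡ (sym a≡) ⟩
            suc p + a                      ∎)
            where
            lemma : ∀ e q r → e + q * suc r ≡ q + (e + r * q)
            lemma = solve-∀
          corner : b * p + c * suc r ≤ b * e + c * (2 + r)
          corner = +-cancelˡ-≤ b _ _ (begin
            b + (b * p + c * suc r)         ≡⟨ lemma₁ b c p (suc r) ⟩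
            suc p * b + c * suc r           ≡⟨ cong (λ q → q * b + c * suc r) q≡ ⟨
            q * b + c * suc r               ≡⟨ cong (_+ c * suc r) relation ⟨
            c + s * a + c * suc r           ≤⟨ +-monoˡ-≤ (c * suc r) (+-monoʳ-≤ c sa≤) ⟩
            c + b * suc e + c * suc r       ≡⟨ lemma₂ b c e (suc r) ⟩
            b + (b * e + c * (2 + r))       ∎)
            where
            lemma₁ : ∀ b c p r → b + (b * p + c * r) ≡ suc p * b + c * r
            lemma₁ = solve-∀
            lemma₂ : ∀ b c e r → c + b * suc e + c * r ≡ b + (b * e + c * suc r)
            lemma₂ = solve-∀

        -- Now (p , r + 1) is the larger corner, and it has w = t + a for t = q - e - 2. This is a
        -- natural number since b (e + 1) < s a ≤ s b forces e + 1 < s ≤ q.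
        frobenius-small-q-< : ∀ {g} → b * suc e < s * a →
                              g ℤ.+ + a ≡ + (b * p + c * suc r) → IsFrobeniusNumber 1 as g
        frobenius-small-q-< <sa g≡ with m≤n⇒∃[o]m+o≡n 1+e<q
          where
          1+e<q : suc e < q
          1+e<q = <-≤-trans (*-cancelˡ-< b (suc e) s (<-≤-trans <sa
                    (≤-trans (*-monoʳ-≤ s a≤b) (≤-reflexive (*-comm s b)))))
                    (≤-trans (m≤n*m s 2) 2s≤q)
        ... | t , 2+e+t≡q =
          frobenius₁ {t = t} {p} {suc r} (≤-trans t<q q≤a) t<q p<q
            (bound (≤-trans (<⇒≤ p<q) q≤a)) top g≡ (twice-per-residue corner ≤-refl)
          where
          p<q : p < q
          p<q = ≤-reflexive (sym q≡)
          t<q : t < q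
          t<q = subst (t <_) 2+e+t≡q (s≤s (m≤n+m t (suc e)))
          top : p + q * suc r ≡ t + a
          top = begin-equality
            p + q * suc r                ≡⟨ cong (_+ q * suc r) (suc-injective (trans 2+e+t≡q q≡)) ⟨
            suc e + t + q * suc r        ≡⟨ lemma (suc e) t q (suc r) ⟩
            t + (suc e + suc r * q)      ≡⟨ cong (λ a → t + a) a≡ ⟨
            t + a                        ∎
            where
            lemma : ∀ e t q r → e + t + q * r ≡ t + (e + r * q)
            lemma = solve-∀
          corner : b * e + c * (2 + r) ≤ b * p + c * suc r
          corner = +-cancelˡ-≤ b _ _ (begin
            b + (b * e + c * (2 + r))       ≡⟨ lemma₁ b c e (suc r) ⟩
            c + b * suc e + c * suc r       ≤⟨ +-monoˡ-≤ (c * suc r) (+-monoʳ-≤ c (<⇒≤ <sa)) ⟩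
            c + s * a + c * suc r           ≡⟨ cong (_+ c * suc r) relation ⟩
            q * b + c * suc r               ≡⟨ cong (λ q → q * b + c * suc r) q≡ ⟩
            suc p * b + c * suc r           ≡⟨ lemma₂ b c p (suc r) ⟩
            b + (b * p + c * suc r)         ∎)
            where
            lemma₁ : ∀ b c e r → b + (b * e + c * suc r) ≡ c + b * suc e + c * r
            lemma₁ = solve-∀
            lemma₂ : ∀ b c p r → suc p * b + c * r ≡ b + (b * p + c * r)
            lemma₂ = solve-∀

-- Fibonacci identities, monotonicity and coprimality.

module Fibonacci where

  import Data.Integer as ℤ
  open ℤ using (ℤ; +_)
  import Data.Integer.Properties as ℤ
  import Data.Integer.Tactic.RingSolver as ℤ-Solver
  open import Data.Nat.Base
  open import Data.Nat.Properties
  open import Data.Nat.DivMod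
  open import Data.Nat.Coprimality as Coprimality using (Coprime)
  open import Data.Nat.Tactic.RingSolver using (solve-∀)
  open import Data.Product.Base using (_×_; _,_)
  open import Data.Vec.Base using ([]; _∷_)
  open import Function.Base using (_∘_)
  open import Relation.Binary.PropositionalEquality
  open import Relation.Nullary.Negation using (contradiction)
  open Residues

  F-step : ∀ n → F n ≤ F (suc n)
  F-step zero    = z≤n
  F-step (suc n) = m≤m+n (F (suc n)) (F n)

  F-mono-≤ : ∀ {m n} → m ≤ n → F m ≤ F n
  F-mono-≤ {m} m≤n with m≤n⇒∃[o]m+o≡n m≤n
  ... | o , refl = climb m o
    where
    climb : ∀ m o → F m ≤ F (m + o)
    climb m zero    = ≤-reflexive (cong F (sym (+-identityʳ m)))
    climb m (suc o) = ≤-trans (climb m o) (subst (λ e → F (m + o) ≤ F e) (sym (+-suc m o)) (F-step (m + o)))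

  -- The bound 2 ≤ m excludes the repetition F 1 = F 2.
  F-mono-< : ∀ {m n} → 2 ≤ m → m < n → F m < F n
  F-mono-< {suc (suc m)} (s≤s (s≤s _)) m<n = <-≤-trans
    (m<m+n (F (2 + m)) (>-nonZero⁻¹ (F (suc m)) {{F-nonZero (suc m)}})) (F-mono-≤ m<n)

  -- For fixed `i` both sides satisfy the Fibonacci recurrence in `k`, so the cases 0 and 1
  -- determine the rest.
  F-shift : ∀ i k → F (2 + k + i) + F k * F i ≡ F (2 + k) * F (2 + i)
  F-shift i zero          = trans (+-identityʳ _) (sym (+-identityʳ _))
  F-shift i (suc zero)    = lemma (F (suc i)) (F i)
    where
    lemma : ∀ x y → x + y + x + (y + 0) ≡ x + y + (x + y + 0)
    lemma = solve-∀
  F-shift i (suc (suc k)) = begin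
    F (3 + k + i) + F (2 + k + i) + (F (suc k) + F k) * F i              ≡⟨ lemma (F (3 + k + i)) (F (2 + k + i)) (F (suc k)) (F k) (F i) ⟩
    F (3 + k + i) + F (suc k) * F i + (F (2 + k + i) + F k * F i)        ≡⟨ cong₂ _+_ (F-shift i (suc k)) (F-shift i k) ⟩
    F (3 + k) * F (2 + i) + F (2 + k) * F (2 + i)                        ≡⟨ *-distribʳ-+ (F (2 + i)) (F (3 + k)) (F (2 + k)) ⟨
    F (4 + k) * F (2 + i)                                                ∎
    where
    open ≡-Reasoning
    lemma : ∀ x y u v w → x + y + (u + v) * w ≡ x + u * w + (y + v * w)
    lemma = solve-∀

  F-relation : ∀ i {k} → 2 ≤ k → F (i + k) + F (k ∸ 2) * F i ≡ F k * F (i + 2)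
  F-relation i {suc (suc k)} (s≤s (s≤s _)) rewrite +-comm i (2 + k) | +-comm i 2 = F-shift i k

  F-coprime : ∀ n → Coprime (F n) (F (suc n))
  F-coprime zero    = Coprimality.sym (Coprimality.1-coprimeTo 0)
  F-coprime (suc n) = Coprimality.sym (subst (λ e → Coprime e (F (suc n))) (+-comm (F n) (F (suc n)))
                        (coprime-+ˡ (F-coprime n)))
    where
    coprime-+ˡ : ∀ {m n} → Coprime m n → Coprime (m + n) n
    coprime-+ˡ {m} {n} p = subst (λ e → Coprime e n) (+-comm n m) (Coprimality.coprime-+ p)

  F-coprime₂ : ∀ n → Coprime (F n) (F (n + 2))
  F-coprime₂ n = subst (Coprime (F n) ∘ F) (+-comm 2 n)
    (subst (Coprime (F n)) (+-comm (F n) (F (suc n)))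
      (Coprimality.sym (Coprimality.coprime-+ (Coprimality.sym (F-coprime n)))))

  2*F≤F₊₂ : ∀ n → 2 * F n ≤ F (n + 2)
  2*F≤F₊₂ n = subst (λ m → 2 * F n ≤ F m) (+-comm 2 n)
    (+-mono-≤ (F-step n) (≤-reflexive (+-identityʳ (F n))))

  2*F₋₂≤F : ∀ {k} → 2 ≤ k → 2 * F (k ∸ 2) ≤ F k
  2*F₋₂≤F {k} 2≤k = subst (λ m → 2 * F (k ∸ 2) ≤ F m) (m∸n+n≡m 2≤k) (2*F≤F₊₂ (k ∸ 2))

  1≤[m∸1]/n⇒n<m : ∀ {m n} .{{_ : NonZero m}} .{{_ : NonZero n}} → 1 ≤ (m ∸ 1) / n → n < m
  1≤[m∸1]/n⇒n<m {suc m} {n} 1≤r = s≤s (m/n≢0⇒n≤m λ r≡0 → contradiction 1≤r (subst (1 ≰_) (sym r≡0) λ ()))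

  n<m⇒1≤[m∸1]/n : ∀ {m n} .{{_ : NonZero n}} → n < m → 1 ≤ (m ∸ 1) / n
  n<m⇒1≤[m∸1]/n {suc m} (s≤s n≤m) = m≥n⇒m/n>0 n≤m

  -- Both conditions say F k < F i: the numerator F i - 1 makes the inequality strict, and `F` is
  -- strictly increasing from index 2 on.
  quotient-bound : ∀ {i k} .{{_ : NonZero (F k)}} → 2 ≤ i → 2 ≤ k →
                   (1 ≤ (F i ∸ 1) / F k → k ≤ i ∸ 1) × (k ≤ i ∸ 1 → 1 ≤ (F i ∸ 1) / F k)
  quotient-bound {i@(suc _)} {k} 2≤i 2≤k =
    (λ 1≤r → s≤s⁻¹ (≰⇒> λ i≤k → <⇒≱ (1≤[m∸1]/n⇒n<m {{F-nonZero i}} 1≤r) (F-mono-≤ i≤k))) ,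
    (λ k≤i∸1 → n<m⇒1≤[m∸1]/n (F-mono-< 2≤k (s≤s k≤i∸1)))

  -- `Y` and `Z` are coefficients as the closed formulas write them, with integer subtraction; each
  -- is matched with a natural number separately.
  frobenius-ℤ : ∀ a b c y z {Y Z : ℤ} → Y ≡ + y → Z ≡ + z →
                Y ℤ.* + b ℤ.+ Z ℤ.* + c ℤ.- + a ℤ.+ + a ≡ + (b * y + c * z)
  frobenius-ℤ a b c y z refl refl = begin
    + y ℤ.* + b ℤ.+ + z ℤ.* + c ℤ.- + a ℤ.+ + a  ≡⟨ lemma (+ a) (+ b) (+ c) (+ y) (+ z) ⟩
    + b ℤ.* + y ℤ.+ + c ℤ.* + z                  ≡⟨ cong₂ ℤ._+_ (ℤ.pos-* b y) (ℤ.pos-* c z) ⟨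
    + (b * y) ℤ.+ + (c * z)                      ≡⟨⟩
    + (b * y + c * z)                            ∎
    where
    open ≡-Reasoning
    lemma : ∀ a b c y z → y ℤ.* b ℤ.+ z ℤ.* c ℤ.- a ℤ.+ a ≡ b ℤ.* y ℤ.+ c ℤ.* z
    lemma = ℤ-Solver.solve-∀

  -- The general results for the triple F i, F (i + 2), F (i + k).

  module _ {i k : ℕ} (3≤i : 3 ≤ i) (3≤k : 3 ≤ k) where

    private
      a = F i
      b = F (i + 2)
      c = F (i + k)
      q = F k
      s = F (k ∸ 2)
      0<i : 0 < i
      0<i = ≤-trans (s≤s z≤n) 3≤i
      2≤k : 2 ≤ k
      2≤k = ≤-trans (n≤1+n 2) 3≤k

      instance
        a≢0 : NonZero a
        a≢0 = F-nonZero i {{>-nonZero 0<i}}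
        b≢0 : NonZero b
        b≢0 = F-nonZero (i + 2) {{>-nonZero (≤-trans 0<i (m≤m+n i 2))}}
        c≢0 : NonZero c
        c≢0 = F-nonZero (i + k) {{>-nonZero (≤-trans 0<i (m≤m+n i k))}}
        q≢0 : NonZero q
        q≢0 = F-nonZero k {{>-nonZero (≤-trans (s≤s z≤n) 3≤k)}}

      open Triple a b c q s (F-coprime₂ i) (F-relation i 2≤k)

    g₁-large : i + 2 ≤ k → IsFrobeniusNumber 1 (a ∷ b ∷ c ∷ [])
      ((+ 2 ℤ.* + a ℤ.- + 1) ℤ.* + b ℤ.- + a)
    g₁-large i+2≤k = frobenius-large-q (2*F≤F₊₂ i) (2*F₋₂≤F 2≤k)
      (≤-trans (2*F≤F₊₂ i) (F-mono-≤ i+2≤k)) (suc-pred (2 * a))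
      (trans (lemma (+ a) (+ b) (+ c) (+ 2 ℤ.* + a ℤ.- + 1))
        (frobenius-ℤ a b c (pred (2 * a)) 0 coefficient refl))
      where
      instance
        2*a≢0 : NonZero (2 * a)
        2*a≢0 = m*n≢0 2 a
      coefficient : + 2 ℤ.* + a ℤ.- + 1 ≡ + pred (2 * a)
      coefficient = cong (ℤ._- + 1) (trans (sym (ℤ.pos-* 2 a)) (cong +_ (sym (suc-pred (2 * a)))))
      lemma : ∀ a b c y → y ℤ.* b ℤ.- a ℤ.+ a ≡ y ℤ.* b ℤ.+ + 0 ℤ.* c ℤ.- a ℤ.+ a
      lemma = ℤ-Solver.solve-∀

    -- Serves both k = i, where y = 2 a - q is F i, and k = i + 1, where it is F (i - 2).
    g₁-medium : ∀ {y} .{{_ : NonZero y}} → a ≤ q → q + y ≡ 2 * a → s ≤ 2 * y →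
                IsFrobeniusNumber 1 (a ∷ b ∷ c ∷ [])
                  ((+ y ℤ.- + 1) ℤ.* + b ℤ.+ + c ℤ.- + a)
    g₁-medium {suc y} a≤q q+y≡2a s≤2y = frobenius-medium-q (2*F≤F₊₂ i) (2*F₋₂≤F 2≤k)
      a≤q q+y≡2a s≤2y
      (trans (lemma (+ a) (+ b) (+ c) (+ y)) (frobenius-ℤ a b c y 1 refl refl))
      where
      lemma : ∀ a b c y → y ℤ.* b ℤ.+ c ℤ.- a ℤ.+ a ≡ y ℤ.* b ℤ.+ + 1 ℤ.* c ℤ.- a ℤ.+ a
      lemma = ℤ-Solver.solve-∀

    module _ (1≤r : 1 ≤ (a ∸ 1) / q) where

      private
        r = (a ∸ 1) / q
        e = (a ∸ 1) % q
        p = pred q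

        instance
          r≢0 : NonZero r
          r≢0 = >-nonZero 1≤r

        -- The results for small `q` take the quotient as a successor, so `r` enters as
        -- `suc (pred r)`.
        a≡ : a ≡ suc e + suc (pred r) * q
        a≡ = begin
          a                           ≡⟨ suc-pred a ⟨
          suc (a ∸ 1)                 ≡⟨ cong suc (m≡m%n+[m/n]*n (a ∸ 1) q) ⟩
          suc e + r * q               ≡⟨ cong (λ r → suc e + r * q) (suc-pred r) ⟨
          suc e + suc (pred r) * q    ∎
          where open ≡-Reasoning

        -- The value is `suc e` and not `e` because `r` and `e` come from dividing a - 1.
        remainder : + a ℤ.- + r ℤ.* + q ≡ + suc e
        remainder = begin
          + a ℤ.- + r ℤ.* + q                       ≡⟨ cong (λ a → + a ℤ.- + r ℤ.* + q) (trans a≡ (cong (λ r → suc e + r * q) (suc-pred r))) ⟩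
          + suc e ℤ.+ + (r * q) ℤ.- + r ℤ.* + q     ≡⟨ cong (λ v → + suc e ℤ.+ v ℤ.- + r ℤ.* + q) (ℤ.pos-* r q) ⟩
          + suc e ℤ.+ + r ℤ.* + q ℤ.- + r ℤ.* + q   ≡⟨ lemma (+ suc e) (+ r ℤ.* + q) ⟩
          + suc e                                   ∎
          where
          open ≡-Reasoning
          lemma : ∀ x y → x ℤ.+ y ℤ.- y ≡ x
          lemma = ℤ-Solver.solve-∀

        -- Translates the integer inequality separating the two cases into the comparison of
        -- `b * suc e` with `s * a`, that is, of the two corners.
        remainder*b : (+ a ℤ.- + r ℤ.* + q) ℤ.* + b ≡ + (b * suc e)
        remainder*b = trans (cong (ℤ._* + b) remainder)
          (trans (ℤ.*-comm (+ suc e) (+ b)) (sym (ℤ.pos-* b (suc e))))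

      g₁-small-≥ : (+ a ℤ.- + r ℤ.* + q) ℤ.* + b ℤ.≥ + s ℤ.* + a →
        IsFrobeniusNumber 1 (a ∷ b ∷ c ∷ [])
          ((+ a ℤ.- + r ℤ.* + q ℤ.- + 1) ℤ.* + b ℤ.+ (+ r ℤ.+ + 1) ℤ.* + c ℤ.- + a)
      g₁-small-≥ ≥sa = frobenius-small-q-≥ (2*F≤F₊₂ i) (2*F₋₂≤F 2≤k) a≡ (sym (suc-pred q)) (m%n<n (a ∸ 1) q)
        (ℤ.drop‿+≤+ (subst₂ ℤ._≤_ (sym (ℤ.pos-* s a)) remainder*b ≥sa))
        (frobenius-ℤ a b c e (2 + pred r) (cong (ℤ._- + 1) remainder)
          (cong +_ (trans (+-comm r 1) (cong suc (sym (suc-pred r))))))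

      g₁-small-< : (+ a ℤ.- + r ℤ.* + q) ℤ.* + b ℤ.< + s ℤ.* + a →
        IsFrobeniusNumber 1 (a ∷ b ∷ c ∷ [])
          ((+ q ℤ.- + 1) ℤ.* + b ℤ.+ + r ℤ.* + c ℤ.- + a)
      g₁-small-< <sa = frobenius-small-q-< (2*F≤F₊₂ i) (2*F₋₂≤F 2≤k) a≡ (sym (suc-pred q)) (m%n<n (a ∸ 1) q)
        (ℤ.drop‿+<+ (subst₂ ℤ._<_ remainder*b (sym (ℤ.pos-* s a)) <sa))
        (frobenius-ℤ a b c p (suc (pred r)) (cong (ℤ._- + 1) (cong +_ (sym (suc-pred q))))
          (cong +_ (sym (suc-pred r))))

  g₁-suc : ∀ {i} → 3 ≤ i → IsFrobeniusNumber 1 (F i ∷ F (i + 2) ∷ F (2 * i + 1) ∷ [])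
           ((+ F (i ∸ 2) ℤ.- + 1) ℤ.* + F (i + 2) ℤ.+ + F (2 * i + 1) ℤ.- + F i)
  g₁-suc {i@(suc (suc (suc j)))} 3≤i@(s≤s (s≤s (s≤s _))) = subst
    (λ n → IsFrobeniusNumber 1 (F i ∷ F (i + 2) ∷ F n ∷ [])
             ((+ F (i ∸ 2) ℤ.- + 1) ℤ.* + F (i + 2) ℤ.+ + F n ℤ.- + F i))
    (index i)
    (g₁-medium 3≤i (≤-trans 3≤i (n≤1+n i)) {{F-nonZero (suc j)}} (F-step i)
      (lemma (F (2 + j)) (F (suc j)))
      -- For k = i + 1, `s` is F (i - 1) = F (i - 2) + F (i - 3), at most twice F (i - 2).
      (+-monoʳ-≤ (F (suc j)) (≤-trans (F-step j) (m≤m+n _ 0))))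
    where
    index : ∀ i → i + suc i ≡ 2 * i + 1
    index = solve-∀
    lemma : ∀ x y → x + y + x + y ≡ 2 * (x + y)
    lemma = solve-∀

  g₁-double : ∀ {i} → 3 ≤ i → IsFrobeniusNumber 1 (F i ∷ F (i + 2) ∷ F (2 * i) ∷ [])
              ((+ F i ℤ.- + 1) ℤ.* + F (i + 2) ℤ.+ + F (2 * i) ℤ.- + F i)
  g₁-double {i} 3≤i = subst
    (λ n → IsFrobeniusNumber 1 (F i ∷ F (i + 2) ∷ F n ∷ [])
             ((+ F i ℤ.- + 1) ℤ.* + F (i + 2) ℤ.+ + F n ℤ.- + F i))
    (cong (λ e → i + e) (sym (+-identityʳ i)))
    (g₁-medium 3≤i 3≤i {{F-nonZero i {{>-nonZero (≤-trans (s≤s z≤n) 3≤i)}}}} ≤-refl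
      (cong (λ e → F i + e) (sym (+-identityʳ (F i))))
      (≤-trans (F-mono-≤ (m∸n≤m i 2)) (m≤n*m (F i) 2)))

-- The formulas for Fibonacci triples, assembled from the three ranges of F k.

open import Data.Nat as ℕ using (ℕ; _∸_; NonZero; >-nonZero)
open import Data.Nat.Properties using (≤-trans)
open import Data.Integer using (ℤ; +_; _+_; _-_; _*_; _<_; _≥_)
open import Data.Vec using ([]; _∷_)
open import Data.Product using (_×_)
open import Function.Bundles using (_⇔_)
open import Data.Product using (_,_; uncurry)
open import Function.Bundles using (mk⇔)

theorem2 : (i k : ℕ) → 3 ℕ.≤ i → (k≥3 : 3 ℕ.≤ k) →
  let
    f : ℕ → ℤ
    f n = + F n
    instance
      k≢0 : NonZero k
      k≢0 = >-nonZero (≤-trans (ℕ.s≤s ℕ.z≤n) k≥3)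
      Fk≢0 : NonZero (F k)
      Fk≢0 = F-nonZero k
    r : ℕ
    r = (F i ∸ 1) ℕ./ F k
  in
    (i ℕ.+ 2 ℕ.≤ k →
      IsFrobeniusNumber 1 (F i ∷ F (i ℕ.+ 2) ∷ F (i ℕ.+ k) ∷ [])
        ((+ 2 * f i - + 1) * f (i ℕ.+ 2) - f i))
  × IsFrobeniusNumber 1 (F i ∷ F (i ℕ.+ 2) ∷ F (2 ℕ.* i ℕ.+ 1) ∷ [])
      ((f (i ∸ 2) - + 1) * f (i ℕ.+ 2) + f (2 ℕ.* i ℕ.+ 1) - f i)
  × IsFrobeniusNumber 1 (F i ∷ F (i ℕ.+ 2) ∷ F (2 ℕ.* i) ∷ [])
      ((f i - + 1) * f (i ℕ.+ 2) + f (2 ℕ.* i) - f i)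
  × (1 ℕ.≤ r ⇔ k ℕ.≤ i ∸ 1)
  × (1 ℕ.≤ r →
      ((f i - + r * f k) * f (i ℕ.+ 2) ≥ f (k ∸ 2) * f i →
        IsFrobeniusNumber 1 (F i ∷ F (i ℕ.+ 2) ∷ F (i ℕ.+ k) ∷ [])
          ((f i - + r * f k - + 1) * f (i ℕ.+ 2) + (+ r + + 1) * f (i ℕ.+ k) - f i))
      × ((f i - + r * f k) * f (i ℕ.+ 2) < f (k ∸ 2) * f i →
        IsFrobeniusNumber 1 (F i ∷ F (i ℕ.+ 2) ∷ F (i ℕ.+ k) ∷ [])
          ((f k - + 1) * f (i ℕ.+ 2) + + r * f (i ℕ.+ k) - f i)))
theorem2 i k 3≤i 3≤k =
    g₁-large 3≤i 3≤k
  , g₁-suc 3≤i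
  , g₁-double 3≤i
  , uncurry mk⇔ (quotient-bound 2≤i 2≤k)
  , λ 1≤r → g₁-small-≥ 3≤i 3≤k 1≤r , g₁-small-< 3≤i 3≤k 1≤r
  where
  open Fibonacci
  2≤i = ≤-trans (ℕ.s≤s (ℕ.s≤s ℕ.z≤n)) 3≤i
  2≤k = ≤-trans (ℕ.s≤s (ℕ.s≤s ℕ.z≤n)) 3≤k
  instance
    Fk≢0 : NonZero (F k)
    Fk≢0 = F-nonZero k {{>-nonZero (≤-trans (ℕ.s≤s ℕ.z≤n) 3≤k)}}
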